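{- Let $G_1$ and $G_2$ be two vertex-disjoint simple connected graphs with $|V(G_1)|=n_1$, $|V(G_2)|=n_2$, $|E(G_1)|=m_1$, $|E(G_2)|=m_2$. Then the vertex T-join $G_1\dot{\vee}_T G_2$ satisfies \[ F(G_1\dot{\vee}_T G_2)=8F(G_1)+F(G_2)+12n_2M_1(G_1)+3n_1M_1(G_2)+M_4(G_1)+3\,ReZM(G_1)+12m_1n_2^{2}+6m_2n_1^{2}+n_1n_2(n_1^2+n_2^2). \]
   Context: For a simple graph $G$ and $v\in V(G)$, $d_G(v)$ is the degree of $v$. Define $M_1(G)=\sum_{v\in V(G)}d_G(v)^2$, $F(G)=\sum_{v\in V(G)}d_G(v)^3$, $M_4(G)=\sum_{v\in V(G)}d_G(v)^4$, and $ReZM(G)=\sum_{uv\in E(G)}d_G(u)d_G(v)\,[d_G(u)+d_G(v)]$. The total graph $T(G)$ is obtained from $G$ (keeping all edges of $G$) by inserting a new vertex for each edge of $G$, joining each new vertex to the two end vertices of its edge, and joining by an edge each pair of new vertices corresponding to adjacent edges of $G$ (edges sharing an end vertex); let $I(G)$ denote the set of these new vertices, so $V(T(G))=V(G)\cup I(G)$. The vertex T-join $G_1\dot{\vee}_T G_2$ is the graph obtained from $T(G_1)$ and $G_2$ (taken vertex-disjoint) by joining each vertex of $V(G_1)$ to every vertex of $G_2$ by an edge. -}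

module Defs where

open import Data.Empty using (⊥)
open import Data.Fin using (Fin)
import Data.Fin.Properties as Fin
open import Data.List using (List; []; _∷_; _++_; map; filter; length; lookup; allFin)
open import Data.List.Membership.Propositional using (_∈_; lose; find)
open import Data.List.Membership.Propositional.Properties
  using (∈-map⁺; ∈-map⁻; ∈-++⁺ˡ; ∈-++⁺ʳ; ∈-allFin)
open import Data.List.Relation.Unary.Any using (any?)
open import Data.List.Relation.Unary.Enumerates.Setoid using (IsEnumeration)
open import Data.List.Relation.Unary.Unique.Propositional using (Unique)
import Data.List.Relation.Unary.Unique.Propositional.Properties as Unique
open import Data.Nat using (ℕ; _+_; _*_; _^_)
open import Data.Nat.ListAction using (sum)
open import Data.Product using (_×_; _,_; proj₁; proj₂; ∃-syntax; uncurry)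
open import Data.Sum using (_⊎_; inj₁; inj₂)
import Data.Sum.Properties as Sum
open import Data.Unit using (⊤; tt)
open import Relation.Binary
  using (Rel; Decidable; DecidableEquality; Symmetric; Irreflexive)
open import Relation.Binary.Construct.Closure.ReflexiveTransitive using (Star)
open import Relation.Binary.PropositionalEquality
  using (_≡_; _≢_; refl; sym; setoid)
open import Relation.Nullary using (Dec; yes; no)
open import Relation.Nullary.Decidable using (_×-dec_; _⊎-dec_; ¬?; map′)
open import Level using (0ℓ)

record SimpleGraph : Set₁ where
  infix 4 _≟_
  field
    V        : Set
    _≟_      : DecidableEquality V
    vertices : List V
    complete : IsEnumeration (setoid V) vertices
    unique   : Unique vertices
    Adj      : Rel V 0ℓ
    adj?     : Decidable Adj
    adj-sym  : Symmetric Adj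
    adj-irr  : Irreflexive _≡_ Adj

-- All (xᵢ , xⱼ) with i < j.
pairs : ∀ {A : Set} → List A → List (A × A)
pairs []       = []
pairs (x ∷ xs) = map (x ,_) xs ++ pairs xs

module _ (G : SimpleGraph) where
  open SimpleGraph G

  -- Since `vertices` has no repetitions, each edge uv is listed exactly once,
  -- as (u , v) with u before v in `vertices`.
  edges : List (V × V)
  edges = filter (uncurry adj?) (pairs vertices)

  order size : ℕ
  order = length vertices
  size  = length edges

  deg : V → ℕ
  deg v = length (filter (adj? v) vertices)

  M₁ F M₄ ReZM : ℕ
  M₁   = sum (map (λ v → deg v ^ 2) vertices)
  F    = sum (map (λ v → deg v ^ 3) vertices)
  M₄   = sum (map (λ v → deg v ^ 4) vertices)
  ReZM = sum (map (λ { (u , v) → deg u * deg v * (deg u + deg v) }) edges)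

  -- The null graph is not counted as connected.
  Connected : Set
  Connected = V × (∀ u v → Star Adj u v)

  Edge : Set
  Edge = Fin size

  infix 4 _IsEndOf_
  _IsEndOf_ : V → Edge → Set
  v IsEndOf e = v ≡ proj₁ (lookup edges e) ⊎ v ≡ proj₂ (lookup edges e)

  isEndOf? : ∀ v e → Dec (v IsEndOf e)
  isEndOf? v e = (v ≟ proj₁ (lookup edges e)) ⊎-dec (v ≟ proj₂ (lookup edges e))

  AdjacentEdges : Rel Edge 0ℓ
  AdjacentEdges e f = e ≢ f × ∃[ v ] (v IsEndOf e × v IsEndOf f)

  adjacentEdges? : Decidable AdjacentEdges
  adjacentEdges? e f = ¬? (e Fin.≟ f) ×-dec
    map′ (λ p → let v , _ , q = find p in v , q) (λ { (v , q) → lose (complete v) q })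
         (any? (λ v → isEndOf? v e ×-dec isEndOf? v f) vertices)

⊎-vertices : ∀ {A B : Set} → List A → List B → List (A ⊎ B)
⊎-vertices xs ys = map inj₁ xs ++ map inj₂ ys

⊎-complete : ∀ {A B : Set} {xs : List A} {ys : List B} →
  IsEnumeration (setoid A) xs → IsEnumeration (setoid B) ys →
  IsEnumeration (setoid (A ⊎ B)) (⊎-vertices xs ys)
⊎-complete cx cy (inj₁ x) = ∈-++⁺ˡ (∈-map⁺ inj₁ (cx x))
⊎-complete {xs = xs} cx cy (inj₂ y) = ∈-++⁺ʳ (map inj₁ xs) (∈-map⁺ inj₂ (cy y))

⊎-unique : ∀ {A B : Set} {xs : List A} {ys : List B} →
  Unique xs → Unique ys → Unique (⊎-vertices xs ys)
⊎-unique {xs = xs} {ys} ux uy =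
  Unique.++⁺ (Unique.map⁺ Sum.inj₁-injective ux) (Unique.map⁺ Sum.inj₂-injective uy) disjoint
  where
  disjoint : ∀ {z} → z ∈ map inj₁ xs × z ∈ map inj₂ ys → ⊥
  disjoint (p , q) with ∈-map⁻ inj₁ p | ∈-map⁻ inj₂ q
  ... | _ , _ , refl | _ , _ , ()

module _ (G : SimpleGraph) where
  open SimpleGraph G

  TAdj : Rel (V ⊎ Edge G) 0ℓ
  TAdj (inj₁ u) (inj₁ v) = Adj u v
  TAdj (inj₁ u) (inj₂ e) = _IsEndOf_ G u e
  TAdj (inj₂ e) (inj₁ u) = _IsEndOf_ G u e
  TAdj (inj₂ e) (inj₂ f) = AdjacentEdges G e f

  tAdj? : Decidable TAdj
  tAdj? (inj₁ u) (inj₁ v) = adj? u v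
  tAdj? (inj₁ u) (inj₂ e) = isEndOf? G u e
  tAdj? (inj₂ e) (inj₁ u) = isEndOf? G u e
  tAdj? (inj₂ e) (inj₂ f) = adjacentEdges? G e f

  tAdj-sym : Symmetric TAdj
  tAdj-sym {inj₁ u} {inj₁ v} p = adj-sym p
  tAdj-sym {inj₁ u} {inj₂ e} p = p
  tAdj-sym {inj₂ e} {inj₁ u} p = p
  tAdj-sym {inj₂ e} {inj₂ f} (e≢f , v , p , q) = (λ f≡e → e≢f (sym f≡e)) , v , q , p

  tAdj-irr : Irreflexive _≡_ TAdj
  tAdj-irr {inj₁ u} refl p         = adj-irr refl p
  tAdj-irr {inj₂ e} refl (e≢e , _) = e≢e refl

  totalGraph : SimpleGraph
  totalGraph = record
    { V        = V ⊎ Edge G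
    ; _≟_      = Sum.≡-dec _≟_ Fin._≟_
    ; vertices = ⊎-vertices vertices (allFin (size G))
    ; complete = ⊎-complete complete ∈-allFin
    ; unique   = ⊎-unique unique (Unique.allFin⁺ (size G))
    ; Adj      = TAdj
    ; adj?     = tAdj?
    ; adj-sym  = λ {x} {y} → tAdj-sym {x} {y}
    ; adj-irr  = λ {x} {y} → tAdj-irr {x} {y}
    }

module _ (G₁ G₂ : SimpleGraph) where
  private
    module T  = SimpleGraph (totalGraph G₁)
    module G₂ = SimpleGraph G₂

  JAdj : Rel (T.V ⊎ G₂.V) 0ℓ
  JAdj (inj₁ x)        (inj₁ y)        = T.Adj x y
  JAdj (inj₁ (inj₁ _)) (inj₂ _)        = ⊤
  JAdj (inj₁ (inj₂ _)) (inj₂ _)        = ⊥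
  JAdj (inj₂ _)        (inj₁ (inj₁ _)) = ⊤
  JAdj (inj₂ _)        (inj₁ (inj₂ _)) = ⊥
  JAdj (inj₂ w)        (inj₂ z)        = G₂.Adj w z

  jAdj? : Decidable JAdj
  jAdj? (inj₁ x)        (inj₁ y)        = T.adj? x y
  jAdj? (inj₁ (inj₁ _)) (inj₂ _)        = yes tt
  jAdj? (inj₁ (inj₂ _)) (inj₂ _)        = no λ ()
  jAdj? (inj₂ _)        (inj₁ (inj₁ _)) = yes tt
  jAdj? (inj₂ _)        (inj₁ (inj₂ _)) = no λ ()
  jAdj? (inj₂ w)        (inj₂ z)        = G₂.adj? w z

  jAdj-sym : Symmetric JAdj
  jAdj-sym {inj₁ x}        {inj₁ y}        p = T.adj-sym {x} {y} p
  jAdj-sym {inj₁ (inj₁ _)} {inj₂ _}        p = tt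
  jAdj-sym {inj₂ _}        {inj₁ (inj₁ _)} p = tt
  jAdj-sym {inj₂ w}        {inj₂ z}        p = G₂.adj-sym p

  jAdj-irr : Irreflexive _≡_ JAdj
  jAdj-irr {inj₁ x} refl p = T.adj-irr {x} refl p
  jAdj-irr {inj₂ w} refl p = G₂.adj-irr refl p

  -- The vertex T-join; disjointness of the two vertex sets is that of the sum type.
  vertexTJoin : SimpleGraph
  vertexTJoin = record
    { V        = T.V ⊎ G₂.V
    ; _≟_      = Sum.≡-dec T._≟_ G₂._≟_
    ; vertices = ⊎-vertices T.vertices G₂.vertices
    ; complete = ⊎-complete T.complete G₂.complete
    ; unique   = ⊎-unique T.unique G₂.unique
    ; Adj      = JAdj
    ; adj?     = jAdj?
    ; adj-sym  = λ {x} {y} → jAdj-sym {x} {y}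
    ; adj-irr  = λ {x} {y} → jAdj-irr {x} {y}
    }

{-# OPTIONS --safe #-}
module Submission where

-- In the join, a vertex v of G₁ has degree 2 d(v) + n₂, the new vertex of an edge ab has degree
-- d(a) + d(b), and a vertex w of G₂ has degree d(w) + n₁; expanding the cubes gives the formula,
-- since Σ_{ab ∈ E} (d(a)³ + d(b)³) = Σ_v d(v)⁴ and Σ_v d(v) = 2m.
-- The degrees are found by summing indicators, using that for every h
--   Σ_{ab ∈ E} (h a b + h b a) = Σ_a Σ_b [a ~ b] h a b.
-- For the edges adjacent to ab, count d(a) edges at a plus d(b) edges at b: by inclusion–exclusion
-- this exceeds the number of edges meeting {a, b} by the one edge joining a and b, and those meeting
-- edges include ab itself.

open import Defs
open import Data.Bool using (true; false; if_then_else_)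
import Data.Fin.Properties as Fin
open import Data.List using (List; []; _∷_; _++_; map; filter; length; lookup; tabulate; allFin)
open import Data.List.Membership.Propositional using (_∈_)
open import Data.List.Membership.Propositional.Properties using (∈-allFin; ∈-lookup)
open import Data.List.Properties
  using (map-++; map-∘; map-cong; map-cong-local; map-tabulate; tabulate-lookup)
open import Data.List.Relation.Unary.All as All using (All; []; _∷_)
open import Data.List.Relation.Unary.All.Properties using (all-filter)
open import Data.List.Relation.Unary.AllPairs using ([]; _∷_)
open import Data.List.Relation.Unary.Any using (here; there)
open import Data.List.Relation.Unary.Unique.Propositional using (Unique)
open import Data.List.Relation.Unary.Unique.Propositional.Properties using (allFin⁺)
open import Data.Nat using (ℕ; suc; _+_; _*_; _^_)
open import Data.Nat.ListAction using (sum)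
open import Data.Nat.ListAction.Properties using (sum-++)
open import Data.Nat.Properties
  using (+-identityʳ; *-identityˡ; *-identityʳ; *-zeroʳ; *-comm)
open import Data.Nat.Solver using (module +-*-Solver)
open import Data.Product using (_×_; _,_; proj₁; proj₂; uncurry)
open import Data.Sum using (_⊎_; inj₁; inj₂)
open import Function using (_∘_)
open import Relation.Binary.PropositionalEquality
  using (_≡_; _≢_; refl; sym; trans; cong; cong₂; module ≡-Reasoning)
open import Relation.Nullary using (Dec; yes; no; does; ¬_; contradiction)
open import Relation.Nullary.Decidable using (_×-dec_; _⊎-dec_; dec-true; dec-false)
open import Relation.Unary using (Pred; Decidable)

open +-*-Solver using (solve; con; _:=_; _:+_; _:*_; _:^_)
open ≡-Reasoning

private
  variable
    A B P Q : Set

-- Finite sums over lists and indicators of decidable propositions.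

∑ : List A → (A → ℕ) → ℕ
∑ xs f = sum (map f xs)

infix 9 ∑
syntax ∑ xs (λ x → e) = ∑[ x ∈ xs ] e

𝟙 : Dec P → ℕ
𝟙 p = if does p then 1 else 0

𝟙-true : (p : Dec P) → P → 𝟙 p ≡ 1
𝟙-true p x = cong (if_then 1 else 0) (dec-true p x)

𝟙-false : (p : Dec P) → ¬ P → 𝟙 p ≡ 0
𝟙-false p ¬x = cong (if_then 1 else 0) (dec-false p ¬x)

𝟙-cong : (p : Dec P) (q : Dec Q) → (P → Q) → (Q → P) → 𝟙 p ≡ 𝟙 q
𝟙-cong (yes x) q f g = sym (𝟙-true q (f x))
𝟙-cong (no ¬x) q f g = sym (𝟙-false q (¬x ∘ g))

-- Inclusion-exclusion for two conditions, kept additive so that no subtraction in `ℕ` occurs.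
𝟙-⊎+× : (p : Dec P) (q : Dec Q) → 𝟙 (p ⊎-dec q) + 𝟙 (p ×-dec q) ≡ 𝟙 p + 𝟙 q
𝟙-⊎+× (yes _) q = refl
𝟙-⊎+× (no _)  q = +-identityʳ _

𝟙-⊎ : (p : Dec P) (q : Dec Q) → (P → ¬ Q) → 𝟙 (p ⊎-dec q) ≡ 𝟙 p + 𝟙 q
𝟙-⊎ (yes x) q p⇒¬q = cong suc (sym (𝟙-false q (p⇒¬q x)))
𝟙-⊎ (no _)  q _    = refl

∑-cong : {f g : A → ℕ} (xs : List A) → (∀ x → f x ≡ g x) → ∑ xs f ≡ ∑ xs g
∑-cong xs eq = cong sum (map-cong eq xs)

∑-cong-local : {f g : A → ℕ} {xs : List A} → All (λ x → f x ≡ g x) xs → ∑ xs f ≡ ∑ xs g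
∑-cong-local eqs = cong sum (map-cong-local eqs)

∑-++ : (f : A → ℕ) (xs ys : List A) → ∑ (xs ++ ys) f ≡ ∑ xs f + ∑ ys f
∑-++ f xs ys = trans (cong sum (map-++ f xs ys)) (sum-++ (map f xs) (map f ys))

∑-map : (f : B → ℕ) (g : A → B) (xs : List A) → ∑ (map g xs) f ≡ ∑ xs (f ∘ g)
∑-map f g xs = cong sum (sym (map-∘ xs))

∑-+ : (f g : A → ℕ) (xs : List A) → ∑[ x ∈ xs ] (f x + g x) ≡ ∑ xs f + ∑ xs g
∑-+ f g []       = refl
∑-+ f g (x ∷ xs) rewrite ∑-+ f g xs =
  solve 4 (λ a b s t → (a :+ b) :+ (s :+ t) := (a :+ s) :+ (b :+ t)) refl
    (f x) (g x) (∑ xs f) (∑ xs g)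

∑-*ˡ : (c : ℕ) (f : A → ℕ) (xs : List A) → ∑[ x ∈ xs ] (c * f x) ≡ c * ∑ xs f
∑-*ˡ c f []       = sym (*-zeroʳ c)
∑-*ˡ c f (x ∷ xs) rewrite ∑-*ˡ c f xs =
  solve 3 (λ c a s → c :* a :+ c :* s := c :* (a :+ s)) refl c (f x) (∑ xs f)

∑-const : (c : ℕ) (xs : List A) → ∑[ _ ∈ xs ] c ≡ length xs * c
∑-const c []       = refl
∑-const c (x ∷ xs) = cong (c +_) (∑-const c xs)

∑-filter : {R : Pred A _} (R? : Decidable R) (f : A → ℕ) (xs : List A) →
  ∑ (filter R? xs) f ≡ ∑[ x ∈ xs ] (𝟙 (R? x) * f x)
∑-filter R? f []       = refl
∑-filter R? f (x ∷ xs) with does (R? x)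
... | true  = cong₂ _+_ (sym (+-identityʳ (f x))) (∑-filter R? f xs)
... | false = ∑-filter R? f xs

length-filter : {R : Pred A _} (R? : Decidable R) (xs : List A) →
  length (filter R? xs) ≡ ∑[ x ∈ xs ] 𝟙 (R? x)
length-filter R? []       = refl
length-filter R? (x ∷ xs) with does (R? x)
... | true  = cong suc (length-filter R? xs)
... | false = length-filter R? xs

-- The new vertices of the total graph are indices into `edges`; this turns sums over them into sums
-- over the edges themselves.
∑-lookup : (f : A → ℕ) (xs : List A) →
  ∑[ i ∈ allFin (length xs) ] f (lookup xs i) ≡ ∑ xs f
∑-lookup f xs = cong sum (begin
  map f∘lookup (allFin (length xs)) ≡⟨ map-tabulate (λ i → i) f∘lookup ⟩
  tabulate f∘lookup                 ≡⟨ map-tabulate (lookup xs) f ⟨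
  map f (tabulate (lookup xs))      ≡⟨ cong (map f) (tabulate-lookup xs) ⟩
  map f xs                          ∎)
  where f∘lookup = f ∘ lookup xs

-- The square `xs` × `xs` splits into its diagonal and the pairs of distinct positions, each taken
-- in both orders.
∑-pairs : (h : A → A → ℕ) (xs : List A) →
  ∑ (pairs xs) (λ (x , y) → h x y + h y x) + ∑[ x ∈ xs ] h x x
    ≡ ∑[ x ∈ xs ] (∑[ y ∈ xs ] h x y)
∑-pairs h []       = refl
∑-pairs h (x ∷ xs)
  rewrite ∑-++ (λ (x , y) → h x y + h y x) (map (x ,_) xs) (pairs xs)
        | ∑-map (λ (x , y) → h x y + h y x) (x ,_) xs
        | ∑-+ (h x) (λ y → h y x) xs
        | ∑-+ (λ y → h y x) (λ y → ∑ xs (h y)) xs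
        | sym (∑-pairs h xs) =
  -- The head `x` adds its row `r`, its column `c` and its diagonal entry `d`; `p` and `t` come from
  -- the tail.
  solve 5 (λ r c p d t → ((r :+ c) :+ p) :+ (d :+ t) := (d :+ r) :+ (c :+ (p :+ t))) refl
    (∑ xs (h x)) (∑[ y ∈ xs ] h y x) (∑ (pairs xs) (λ (x , y) → h x y + h y x))
    (h x x) (∑[ y ∈ xs ] h y y)

module _ (_≟_ : (x y : A) → Dec (x ≡ y)) where

  ∑-absent : (f : A → ℕ) {a : A} {xs : List A} → All (a ≢_) xs →
    ∑[ x ∈ xs ] (𝟙 (a ≟ x) * f x) ≡ 0
  ∑-absent f []                   = refl
  ∑-absent f {a} {x ∷ _} (a≢x ∷ a∉xs) rewrite 𝟙-false (a ≟ x) a≢x = ∑-absent f a∉xs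

  -- Sifting by a Kronecker delta: `a` occurs in the list, and by uniqueness all other terms vanish.
  ∑-select : (f : A → ℕ) {a : A} {xs : List A} → Unique xs → a ∈ xs →
    ∑[ x ∈ xs ] (𝟙 (a ≟ x) * f x) ≡ f a
  ∑-select f {a} (a∉xs ∷ _) (here refl) rewrite 𝟙-true (a ≟ a) refl | ∑-absent f a∉xs =
    trans (+-identityʳ _) (*-identityˡ (f a))
  ∑-select f {a} {x ∷ _} (x∉xs ∷ u) (there a∈xs)
    rewrite 𝟙-false (a ≟ x) (λ { refl → All.lookup x∉xs a∈xs refl }) = ∑-select f u a∈xs

-- Binomial expansion under the sum. It serves the degrees 2 d + n₂ and d + n₁ alike.
∑-cubes : (a c : ℕ) (d : A → ℕ) (xs : List A) →
  ∑[ x ∈ xs ] ((a * d x + c) ^ 3)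
    ≡ a ^ 3 * ∑[ x ∈ xs ] (d x ^ 3) + 3 * a ^ 2 * c * ∑[ x ∈ xs ] (d x ^ 2)
      + 3 * a * c ^ 2 * ∑ xs d + c ^ 3 * length xs
∑-cubes a c d []       = solve 2 (λ a c →
  con 0 := a :^ 3 :* con 0 :+ con 3 :* a :^ 2 :* c :* con 0 :+ con 3 :* a :* c :^ 2 :* con 0 :+ c :^ 3 :* con 0)
  refl a c
∑-cubes a c d (x ∷ xs) rewrite ∑-cubes a c d xs =
  solve 7 (λ a c d r s t l →
    (a :* d :+ c) :^ 3 :+ (a :^ 3 :* r :+ con 3 :* a :^ 2 :* c :* s :+ con 3 :* a :* c :^ 2 :* t :+ c :^ 3 :* l)
      := a :^ 3 :* (d :^ 3 :+ r) :+ con 3 :* a :^ 2 :* c :* (d :^ 2 :+ s)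
         :+ con 3 :* a :* c :^ 2 :* (d :+ t) :+ c :^ 3 :* (con 1 :+ l))
    refl a c (d x) (∑[ x ∈ xs ] (d x ^ 3)) (∑[ x ∈ xs ] (d x ^ 2)) (∑ xs d) (length xs)

-- Double counting of edges and incidences in one graph.

module _ (G : SimpleGraph) where
  open SimpleGraph G

  edges-adjacent : All (uncurry Adj) (edges G)
  edges-adjacent = all-filter (uncurry adj?) (pairs vertices)

  deg-∑ : ∀ v → deg G v ≡ ∑[ u ∈ vertices ] 𝟙 (adj? v u)
  deg-∑ v = length-filter (adj? v) vertices

  -- Filtering becomes an indicator factor. This factor is symmetric, so it can be attached to both
  -- orders of a pair, and it kills the diagonal in `∑-pairs`.
  ∑-edges : (h : V → V → ℕ) →
    ∑ (edges G) (λ (u , v) → h u v + h v u)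
      ≡ ∑[ u ∈ vertices ] (∑[ v ∈ vertices ] (𝟙 (adj? u v) * h u v))
  ∑-edges h = begin
    ∑ (edges G) (λ (u , v) → h u v + h v u)
      ≡⟨ ∑-filter (uncurry adj?) _ (pairs vertices) ⟩
    ∑ (pairs vertices) (λ (u , v) → 𝟙 (adj? u v) * (h u v + h v u))
      ≡⟨ ∑-cong (pairs vertices) symmetrise ⟩
    ∑ (pairs vertices) (λ (u , v) → k u v + k v u)
      ≡⟨ +-identityʳ _ ⟨
    ∑ (pairs vertices) (λ (u , v) → k u v + k v u) + 0
      ≡⟨ cong (∑ (pairs vertices) (λ (u , v) → k u v + k v u) +_) diagonal ⟨
    ∑ (pairs vertices) (λ (u , v) → k u v + k v u) + ∑[ u ∈ vertices ] k u u
      ≡⟨ ∑-pairs k vertices ⟩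
    ∑[ u ∈ vertices ] (∑[ v ∈ vertices ] k u v) ∎
    where
    k : V → V → ℕ
    k u v = 𝟙 (adj? u v) * h u v

    symmetrise : ∀ ((u , v) : V × V) → 𝟙 (adj? u v) * (h u v + h v u) ≡ k u v + k v u
    symmetrise (u , v) rewrite 𝟙-cong (adj? v u) (adj? u v) adj-sym adj-sym =
      solve 3 (λ a b c → a :* (b :+ c) := a :* b :+ a :* c) refl (𝟙 (adj? u v)) (h u v) (h v u)

    diagonal : ∑[ u ∈ vertices ] k u u ≡ 0
    diagonal = trans
      (∑-cong vertices λ u → cong (_* h u u) (𝟙-false (adj? u u) (adj-irr refl)))
      (trans (∑-const 0 vertices) (*-zeroʳ (length vertices)))

  -- Each vertex `u` is an end of `deg G u` edges. The weights used below are 1, the indicator of a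
  -- vertex, and the cube of the degree.
  ∑-endpoints : (f : V → ℕ) →
    ∑ (edges G) (λ (u , v) → f u + f v) ≡ ∑[ u ∈ vertices ] (f u * deg G u)
  ∑-endpoints f = trans (∑-edges (λ u _ → f u)) (∑-cong vertices λ u → begin
    ∑[ v ∈ vertices ] (𝟙 (adj? u v) * f u) ≡⟨ ∑-cong vertices (λ v → *-comm _ (f u)) ⟩
    ∑[ v ∈ vertices ] (f u * 𝟙 (adj? u v)) ≡⟨ ∑-*ˡ (f u) _ vertices ⟩
    f u * ∑[ v ∈ vertices ] 𝟙 (adj? u v)   ≡⟨ cong (f u *_) (deg-∑ u) ⟨
    f u * deg G u                          ∎)

  handshake : ∑ vertices (deg G) ≡ size G * 2
  handshake = begin
    ∑ vertices (deg G)                   ≡⟨ ∑-cong vertices (λ u → *-identityˡ (deg G u)) ⟨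
    ∑[ u ∈ vertices ] (1 * deg G u)      ≡⟨ ∑-endpoints (λ _ → 1) ⟨
    ∑[ _ ∈ edges G ] 2                   ≡⟨ ∑-const 2 (edges G) ⟩
    size G * 2                           ∎

  ∑-𝟙-≟ : ∀ v → ∑[ u ∈ vertices ] 𝟙 (v ≟ u) ≡ 1
  ∑-𝟙-≟ v = trans (∑-cong vertices λ u → sym (*-identityʳ _))
                  (∑-select _≟_ (λ _ → 1) unique (complete v))

  -- A version of `isEndOf?` for pairs instead of indices: `isEndOf? G v e` is
  -- `end? v (lookup (edges G) e)` by definition, so `∑-lookup` applies.
  end? : ∀ v ((a , b) : V × V) → Dec (v ≡ a ⊎ v ≡ b)
  end? v (a , b) = (v ≟ a) ⊎-dec (v ≟ b)

  𝟙-end : ∀ v {a b} → Adj a b → 𝟙 (end? v (a , b)) ≡ 𝟙 (v ≟ a) + 𝟙 (v ≟ b)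
  𝟙-end v {a} {b} a~b = 𝟙-⊎ (v ≟ a) (v ≟ b) λ { refl v≡b → adj-irr v≡b a~b }

  incident-edges : ∀ v → ∑[ e ∈ edges G ] 𝟙 (end? v e) ≡ deg G v
  incident-edges v = begin
    ∑[ e ∈ edges G ] 𝟙 (end? v e)
      ≡⟨ ∑-cong-local (All.map (𝟙-end v) edges-adjacent) ⟩
    ∑ (edges G) (λ (a , b) → 𝟙 (v ≟ a) + 𝟙 (v ≟ b)) ≡⟨ ∑-endpoints (λ u → 𝟙 (v ≟ u)) ⟩
    ∑[ u ∈ vertices ] (𝟙 (v ≟ u) * deg G u)
      ≡⟨ ∑-select _≟_ (deg G) unique (complete v) ⟩
    deg G v ∎

  endpoints-of-edge : ∀ {a b} → Adj a b → ∑[ v ∈ vertices ] 𝟙 (end? v (a , b)) ≡ 2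
  endpoints-of-edge {a} {b} a~b = begin
    ∑[ v ∈ vertices ] 𝟙 (end? v (a , b))
      ≡⟨ ∑-cong vertices (λ v → trans (𝟙-end v a~b)
           (cong₂ _+_ (𝟙-cong (v ≟ a) (a ≟ v) sym sym) (𝟙-cong (v ≟ b) (b ≟ v) sym sym))) ⟩
    ∑[ v ∈ vertices ] (𝟙 (a ≟ v) + 𝟙 (b ≟ v))
      ≡⟨ ∑-+ (λ v → 𝟙 (a ≟ v)) (λ v → 𝟙 (b ≟ v)) vertices ⟩
    ∑[ v ∈ vertices ] 𝟙 (a ≟ v) + ∑[ v ∈ vertices ] 𝟙 (b ≟ v)
      ≡⟨ cong₂ _+_ (∑-𝟙-≟ a) (∑-𝟙-≟ b) ⟩
    2 ∎

  -- Distinct `a` and `b` can fill the places `c` and `d` in two ways. The right side has the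
  -- symmetrised form that `∑-edges` expects.
  𝟙-both-ends : ∀ {a b} → a ≢ b → ∀ ((c , d) : V × V) →
    𝟙 (end? a (c , d) ×-dec end? b (c , d)) ≡ 𝟙 (a ≟ c) * 𝟙 (b ≟ d) + 𝟙 (a ≟ d) * 𝟙 (b ≟ c)
  𝟙-both-ends {a} {b} a≢b (c , d) with a ≟ c | a ≟ d | b ≟ c | b ≟ d
  ... | yes refl | _        | yes refl | _        = contradiction refl a≢b
  ... | _        | yes refl | _        | yes refl = contradiction refl a≢b
  -- Here `c` and `d` both equal `a`, which is possible since the pair need not be an edge.
  ... | yes refl | yes refl | no _     | no _     = refl
  ... | yes _    | no _     | no _     | yes _    = refl
  ... | yes _    | no _     | no _     | no _     = refl
  ... | no _     | yes _    | yes _    | no _     = refl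
  ... | no _     | yes _    | no _     | no _     = refl
  ... | no _     | no _     | _        | _        = refl

  -- The product of deltas `h` picks out the single entry at `a`, `b` of the adjacency matrix.
  edges-joining : ∀ {a b} → Adj a b → ∑[ e ∈ edges G ] 𝟙 (end? a e ×-dec end? b e) ≡ 1
  edges-joining {a} {b} a~b = begin
    ∑[ e ∈ edges G ] 𝟙 (end? a e ×-dec end? b e)
      ≡⟨ ∑-cong (edges G) (𝟙-both-ends λ a≡b → adj-irr a≡b a~b) ⟩
    ∑ (edges G) (λ (c , d) → h c d + h d c) ≡⟨ ∑-edges h ⟩
    ∑[ u ∈ vertices ] (∑[ v ∈ vertices ] (𝟙 (adj? u v) * h u v))
      ≡⟨ ∑-cong vertices inner ⟩
    ∑[ u ∈ vertices ] (𝟙 (a ≟ u) * 𝟙 (adj? u b))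
      ≡⟨ ∑-select _≟_ (λ u → 𝟙 (adj? u b)) unique (complete a) ⟩
    𝟙 (adj? a b)  ≡⟨ 𝟙-true (adj? a b) a~b ⟩
    1 ∎
    where
    h : V → V → ℕ
    h u v = 𝟙 (a ≟ u) * 𝟙 (b ≟ v)

    inner : ∀ u → ∑[ v ∈ vertices ] (𝟙 (adj? u v) * h u v) ≡ 𝟙 (a ≟ u) * 𝟙 (adj? u b)
    inner u = begin
      ∑[ v ∈ vertices ] (𝟙 (adj? u v) * h u v)
        ≡⟨ ∑-cong vertices (λ v →
             solve 3 (λ x y z → x :* (y :* z) := y :* (z :* x)) refl
               (𝟙 (adj? u v)) (𝟙 (a ≟ u)) (𝟙 (b ≟ v))) ⟩
      ∑[ v ∈ vertices ] (𝟙 (a ≟ u) * (𝟙 (b ≟ v) * 𝟙 (adj? u v)))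
        ≡⟨ ∑-*ˡ (𝟙 (a ≟ u)) _ vertices ⟩
      𝟙 (a ≟ u) * ∑[ v ∈ vertices ] (𝟙 (b ≟ v) * 𝟙 (adj? u v))
        ≡⟨ cong (𝟙 (a ≟ u) *_) (∑-select _≟_ (λ v → 𝟙 (adj? u v)) unique (complete b)) ⟩
      𝟙 (a ≟ u) * 𝟙 (adj? u b) ∎

  module _ (e : Edge G) where
    private
      a b : V
      a = proj₁ (lookup (edges G) e)
      b = proj₂ (lookup (edges G) e)

      a~b : Adj a b
      a~b = All.lookup edges-adjacent (∈-lookup e)

    -- The `2` stands on the left to avoid truncated subtraction: `e` is counted once at `a` and
    -- once at `b`, but is not adjacent to itself.
    adjacent-edges :
      ∑[ f ∈ allFin (size G) ] 𝟙 (adjacentEdges? G e f) + 2 ≡ deg G a + deg G b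
    adjacent-edges = begin
      L + 2
        ≡⟨ solve 1 (λ l → l :+ con 2 := (l :+ con 1) :+ con 1) refl L ⟩
      (L + 1) + 1
        -- The first 1 is `e` itself among the edges meeting its ends; the second is the overlap
        -- term of inclusion-exclusion.
        ≡⟨ cong₂ (λ x y → (L + x) + y)
             (trans (∑-cong es λ f → sym (*-identityʳ _))
                    (∑-select Fin._≟_ (λ _ → 1) (allFin⁺ (size G)) (∈-allFin e)))
             (edges-joining a~b) ⟨
      (L + ∑[ f ∈ es ] 𝟙 (e Fin.≟ f)) + ∑[ g ∈ edges G ] 𝟙 (end? a g ×-dec end? b g)
        ≡⟨ cong (_+ ∑[ g ∈ edges G ] 𝟙 (end? a g ×-dec end? b g))
             (trans (sym (∑-+ (λ f → 𝟙 (adjacentEdges? G e f)) (λ f → 𝟙 (e Fin.≟ f)) es))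
                    (trans (∑-cong es meet) (∑-lookup _ (edges G)))) ⟩
      ∑[ g ∈ edges G ] 𝟙 (end? a g ⊎-dec end? b g) + ∑[ g ∈ edges G ] 𝟙 (end? a g ×-dec end? b g)
        ≡⟨ ∑-+ _ _ (edges G) ⟨
      ∑[ g ∈ edges G ] (𝟙 (end? a g ⊎-dec end? b g) + 𝟙 (end? a g ×-dec end? b g))
        ≡⟨ ∑-cong (edges G) (λ g → 𝟙-⊎+× (end? a g) (end? b g)) ⟩
      ∑[ g ∈ edges G ] (𝟙 (end? a g) + 𝟙 (end? b g))
        ≡⟨ ∑-+ _ _ (edges G) ⟩
      ∑[ g ∈ edges G ] 𝟙 (end? a g) + ∑[ g ∈ edges G ] 𝟙 (end? b g)
        ≡⟨ cong₂ _+_ (incident-edges a) (incident-edges b) ⟩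
      deg G a + deg G b ∎
      where
      es = allFin (size G)
      L  = ∑[ f ∈ es ] 𝟙 (adjacentEdges? G e f)

      -- Adjacency includes `e ≢ f`, so the two cases exclude each other and their indicators add up
      -- to that of meeting {a, b}.
      meet : ∀ f → 𝟙 (adjacentEdges? G e f) + 𝟙 (e Fin.≟ f)
                     ≡ 𝟙 (isEndOf? G a f ⊎-dec isEndOf? G b f)
      meet f = trans
        (sym (𝟙-⊎ (adjacentEdges? G e f) (e Fin.≟ f) proj₁))
        (𝟙-cong (adjacentEdges? G e f ⊎-dec (e Fin.≟ f)) (isEndOf? G a f ⊎-dec isEndOf? G b f) to from)
        where
        to : AdjacentEdges G e f ⊎ e ≡ f → _IsEndOf_ G a f ⊎ _IsEndOf_ G b f
        to (inj₁ (_ , v , inj₁ refl , v∈f)) = inj₁ v∈f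
        to (inj₁ (_ , v , inj₂ refl , v∈f)) = inj₂ v∈f
        to (inj₂ refl)                      = inj₁ (inj₁ refl)

        from : _IsEndOf_ G a f ⊎ _IsEndOf_ G b f → AdjacentEdges G e f ⊎ e ≡ f
        from p with e Fin.≟ f
        ... | yes e≡f = inj₂ e≡f
        from (inj₁ q) | no e≢f = inj₁ (e≢f , a , inj₁ refl , q)
        from (inj₂ q) | no e≢f = inj₁ (e≢f , b , inj₂ refl , q)

    endpoints : ∑[ v ∈ vertices ] 𝟙 (isEndOf? G v e) ≡ 2
    endpoints = endpoints-of-edge a~b

-- Degrees in the vertex T-join and the sum of their cubes.

∑-⊎-vertices : (f : A ⊎ B → ℕ) (xs : List A) (ys : List B) →
  ∑ (⊎-vertices xs ys) f ≡ ∑ xs (f ∘ inj₁) + ∑ ys (f ∘ inj₂)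
∑-⊎-vertices f xs ys =
  trans (∑-++ f (map inj₁ xs) (map inj₂ ys)) (cong₂ _+_ (∑-map f inj₁ xs) (∑-map f inj₂ ys))

module _ (G₁ G₂ : SimpleGraph) where
  private
    module G₁ = SimpleGraph G₁
    module G₂ = SimpleGraph G₂
    J  = vertexTJoin G₁ G₂
    es = allFin (size G₁)

  ∑-vertexTJoin : (f : SimpleGraph.V J → ℕ) →
    ∑ (SimpleGraph.vertices J) f
      ≡ ∑[ v ∈ G₁.vertices ] f (inj₁ (inj₁ v)) + ∑[ e ∈ es ] f (inj₁ (inj₂ e))
        + ∑[ w ∈ G₂.vertices ] f (inj₂ w)
  ∑-vertexTJoin f = trans
    (∑-⊎-vertices f (⊎-vertices G₁.vertices es) G₂.vertices)
    (cong (_+ ∑ G₂.vertices (f ∘ inj₂)) (∑-⊎-vertices (f ∘ inj₁) G₁.vertices es))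

  deg-vertexTJoin : ∀ x → deg J x
    ≡ ∑[ v ∈ G₁.vertices ] 𝟙 (jAdj? G₁ G₂ x (inj₁ (inj₁ v)))
      + ∑[ e ∈ es ] 𝟙 (jAdj? G₁ G₂ x (inj₁ (inj₂ e)))
      + ∑[ w ∈ G₂.vertices ] 𝟙 (jAdj? G₁ G₂ x (inj₂ w))
  deg-vertexTJoin x =
    trans (length-filter (jAdj? G₁ G₂ x) (SimpleGraph.vertices J)) (∑-vertexTJoin _)

  -- The doubling arises because `v` keeps its neighbours in `G₁` and gains one new vertex for each
  -- edge at `v`.
  deg-original : ∀ v → deg J (inj₁ (inj₁ v)) ≡ 2 * deg G₁ v + order G₂
  deg-original v = trans (deg-vertexTJoin (inj₁ (inj₁ v))) (begin
    ∑[ u ∈ G₁.vertices ] 𝟙 (G₁.adj? v u) + ∑[ e ∈ es ] 𝟙 (isEndOf? G₁ v e) + ∑[ _ ∈ G₂.vertices ] 1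
      ≡⟨ cong₂ _+_ (cong₂ _+_ (sym (deg-∑ G₁ v))
                              (trans (∑-lookup (𝟙 ∘ end? G₁ v) (edges G₁)) (incident-edges G₁ v)))
                   (∑-const 1 G₂.vertices) ⟩
    deg G₁ v + deg G₁ v + order G₂ * 1
      ≡⟨ solve 2 (λ d n → d :+ d :+ n :* con 1 := con 2 :* d :+ n) refl (deg G₁ v) (order G₂) ⟩
    2 * deg G₁ v + order G₂ ∎)

  -- The two ends of `e` supply exactly the 2 that `adjacent-edges` asks for.
  deg-inserted : ∀ e → let (a , b) = lookup (edges G₁) e in
    deg J (inj₁ (inj₂ e)) ≡ deg G₁ a + deg G₁ b
  deg-inserted e = let (a , b) = lookup (edges G₁) e in
    trans (deg-vertexTJoin (inj₁ (inj₂ e))) (begin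
    ∑[ v ∈ G₁.vertices ] 𝟙 (isEndOf? G₁ v e) + L + ∑[ _ ∈ G₂.vertices ] 0
      ≡⟨ cong₂ (λ x y → x + L + y) (endpoints G₁ e) (∑-const 0 G₂.vertices) ⟩
    2 + L + order G₂ * 0
      ≡⟨ solve 2 (λ l n → con 2 :+ l :+ n :* con 0 := l :+ con 2) refl L (order G₂) ⟩
    L + 2
      ≡⟨ adjacent-edges G₁ e ⟩
    deg G₁ a + deg G₁ b ∎)
    where L = ∑[ f ∈ es ] 𝟙 (adjacentEdges? G₁ e f)

  -- The factor `1 *` gives the degree the shape required by `∑-cubes`.
  deg-second : ∀ w → deg J (inj₂ w) ≡ 1 * deg G₂ w + order G₁
  deg-second w = trans (deg-vertexTJoin (inj₂ w)) (begin
    ∑[ _ ∈ G₁.vertices ] 1 + ∑[ _ ∈ es ] 0 + ∑[ z ∈ G₂.vertices ] 𝟙 (G₂.adj? w z)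
      ≡⟨ cong₂ _+_ (cong₂ _+_ (∑-const 1 G₁.vertices) (∑-const 0 es)) (sym (deg-∑ G₂ w)) ⟩
    order G₁ * 1 + length es * 0 + deg G₂ w
      ≡⟨ solve 3 (λ n m d → n :* con 1 :+ m :* con 0 :+ d := con 1 :* d :+ n) refl
           (order G₁) (length es) (deg G₂ w) ⟩
    1 * deg G₂ w + order G₁ ∎)

  -- In (x + y)³ = x³ + y³ + 3xy(x + y) the mixed term is the summand of `ReZM`, and the pure cubes
  -- are summed by `∑-endpoints`.
  ∑-cubes-inserted :
    ∑ (edges G₁) (λ (a , b) → (deg G₁ a + deg G₁ b) ^ 3) ≡ M₄ G₁ + 3 * ReZM G₁
  ∑-cubes-inserted = begin
    ∑ (edges G₁) (λ (a , b) → (deg G₁ a + deg G₁ b) ^ 3)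
      ≡⟨ ∑-cong (edges G₁) (λ (a , b) → solve 2
           (λ x y → (x :+ y) :^ 3 := (x :^ 3 :+ y :^ 3) :+ con 3 :* (x :* y :* (x :+ y)))
           refl (deg G₁ a) (deg G₁ b)) ⟩
    ∑ (edges G₁) (λ (a , b) → (deg G₁ a ^ 3 + deg G₁ b ^ 3) + 3 * r (a , b))
      ≡⟨ ∑-+ (λ (a , b) → deg G₁ a ^ 3 + deg G₁ b ^ 3) (λ e → 3 * r e) (edges G₁) ⟩
    ∑ (edges G₁) (λ (a , b) → deg G₁ a ^ 3 + deg G₁ b ^ 3) + ∑[ e ∈ edges G₁ ] (3 * r e)
      ≡⟨ cong₂ _+_ (trans (∑-endpoints G₁ (λ v → deg G₁ v ^ 3))
                          -- With the factors swapped, `deg G₁ v * deg G₁ v ^ 3` is `deg G₁ v ^ 4`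
                          -- by definition.
                          (∑-cong G₁.vertices λ v → *-comm (deg G₁ v ^ 3) (deg G₁ v)))
                   (∑-*ˡ 3 r (edges G₁)) ⟩
    M₄ G₁ + 3 * ReZM G₁ ∎
    where
    r : G₁.V × G₁.V → ℕ
    r (a , b) = deg G₁ a * deg G₁ b * (deg G₁ a + deg G₁ b)

  -- The three groups belong to the vertices of `G₁`, the new vertices and the vertices of `G₂`; the
  -- coefficients are left as `∑-cubes` produces them for `a` = 2 and `a` = 1.
  F-vertexTJoin : F J ≡
    (2 ^ 3 * F G₁ + 3 * 2 ^ 2 * order G₂ * M₁ G₁ + 3 * 2 * order G₂ ^ 2 * (size G₁ * 2)
      + order G₂ ^ 3 * order G₁)
    + (M₄ G₁ + 3 * ReZM G₁)
    + (1 ^ 3 * F G₂ + 3 * 1 ^ 2 * order G₁ * M₁ G₂ + 3 * 1 * order G₁ ^ 2 * (size G₂ * 2)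
      + order G₁ ^ 3 * order G₂)
  F-vertexTJoin = begin
    F J
      ≡⟨ ∑-vertexTJoin (λ x → deg J x ^ 3) ⟩
    _ ≡⟨ cong₂ _+_ (cong₂ _+_
           (∑-cong G₁.vertices λ v → cong (_^ 3) (deg-original v))
           (trans (∑-cong es λ e → cong (_^ 3) (deg-inserted e))
                  (∑-lookup (λ (a , b) → (deg G₁ a + deg G₁ b) ^ 3) (edges G₁))))
           (∑-cong G₂.vertices λ w → cong (_^ 3) (deg-second w)) ⟩
    ∑[ v ∈ G₁.vertices ] ((2 * deg G₁ v + order G₂) ^ 3)
      + ∑ (edges G₁) (λ (a , b) → (deg G₁ a + deg G₁ b) ^ 3)
      + ∑[ w ∈ G₂.vertices ] ((1 * deg G₂ w + order G₁) ^ 3)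
      ≡⟨ cong₂ _+_ (cong₂ _+_ (shifted 2 (order G₂) G₁) ∑-cubes-inserted) (shifted 1 (order G₁) G₂) ⟩
    _ ∎
    where
    shifted : ∀ a c G →
      ∑[ v ∈ SimpleGraph.vertices G ] ((a * deg G v + c) ^ 3)
        ≡ a ^ 3 * F G + 3 * a ^ 2 * c * M₁ G + 3 * a * c ^ 2 * (size G * 2) + c ^ 3 * order G
    shifted a c G = trans
      (∑-cubes a c (deg G) (SimpleGraph.vertices G))
      (cong (λ s → a ^ 3 * F G + 3 * a ^ 2 * c * M₁ G + 3 * a * c ^ 2 * s + c ^ 3 * order G)
            (handshake G))

theorem7 : (G₁ G₂ : SimpleGraph) (n₁ n₂ m₁ m₂ : ℕ) →
    Connected G₁ → Connected G₂ →
    order G₁ ≡ n₁ → order G₂ ≡ n₂ → size G₁ ≡ m₁ → size G₂ ≡ m₂ →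
    F (vertexTJoin G₁ G₂) ≡
    8 * F G₁ + F G₂ + 12 * n₂ * M₁ G₁ + 3 * n₁ * M₁ G₂ + M₄ G₁ + 3 * ReZM G₁
    + 12 * m₁ * n₂ ^ 2 + 6 * m₂ * n₁ ^ 2 + n₁ * n₂ * (n₁ ^ 2 + n₂ ^ 2)
theorem7 G₁ G₂ n₁ n₂ m₁ m₂ _ _ refl refl refl refl = trans (F-vertexTJoin G₁ G₂)
  -- The numerical coefficients evaluate by computation; n₂³n₁ and n₁³n₂ combine into the last term.
  (solve 10 (λ n₁ n₂ m₁ m₂ f₁ f₂ q₁ q₂ q₄ r →
    (con 8 :* f₁ :+ con 12 :* n₂ :* q₁ :+ con 6 :* n₂ :^ 2 :* (m₁ :* con 2) :+ n₂ :^ 3 :* n₁)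
    :+ (q₄ :+ con 3 :* r)
    :+ (con 1 :* f₂ :+ con 3 :* n₁ :* q₂ :+ con 3 :* n₁ :^ 2 :* (m₂ :* con 2) :+ n₁ :^ 3 :* n₂)
    := con 8 :* f₁ :+ f₂ :+ con 12 :* n₂ :* q₁ :+ con 3 :* n₁ :* q₂ :+ q₄ :+ con 3 :* r
       :+ con 12 :* m₁ :* n₂ :^ 2 :+ con 6 :* m₂ :* n₁ :^ 2 :+ n₁ :* n₂ :* (n₁ :^ 2 :+ n₂ :^ 2))
    refl n₁ n₂ m₁ m₂ (F G₁) (F G₂) (M₁ G₁) (M₁ G₂) (M₄ G₁) (ReZM G₁))
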